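{- For all terms $M, M'$: if $M \to_{\mathsf v}^* M'$, then there exist terms $L, N$ such that $M \to_{h\beta_v}^* L \to_{h\sigma}^* N \to_{int}^* M'$.
   Context: Terms and values of the call-by-value $\lambda$-calculus are defined by mutual induction from a countably infinite set of variables: values $V,U ::= x \mid \lambda x.M$ and terms $M,N,L ::= V \mid MN$. Terms are taken up to $\alpha$-conversion, application associates to the left ($MNL=(MN)L$), $\mathrm{fv}(M)$ denotes the set of free variables of $M$, and $M\{V/x\}$ denotes capture-avoiding substitution of the value $V$ for $x$ in $M$. Every term can be written uniquely as $V N_1\dots N_n$ with $V$ a value and $n\ge 0$. Root rules: $(\lambda x.M)V \mapsto_{\beta_v} M\{V/x\}$ for $V$ a value; $(\lambda x.M)NL \mapsto_{\sigma_1} (\lambda x.ML)N$ if $x\notin\mathrm{fv}(L)$; $V((\lambda x.L)N) \mapsto_{\sigma_3} (\lambda x.VL)N$ for $V$ a value with $x\notin\mathrm{fv}(V)$. Let $\mapsto_\sigma=\mapsto_{\sigma_1}\cup\mapsto_{\sigma_3}$ and $\mapsto_{\mathsf v}=\mapsto_{\beta_v}\cup\mapsto_\sigma$. For each such rule $r$, $\to_r$ is its closure under one-hole contexts $C ::= [\cdot]\mid \lambda x.C\mid CM\mid MC$ (i.e. $C[N]\to_r C[N']$ whenever $N\mapsto_r N'$). For a relation $R$, $R^*$ denotes its reflexive-transitive closure. Head $\beta_v$-reduction $\to_{h\beta_v}$ is the least relation such that: $(\lambda x.M)V M_1\dots M_m \to_{h\beta_v} M\{V/x\}M_1\dots M_m$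 for every value $V$ and $m\ge 0$; and if $N\to_{h\beta_v}N'$ then $VNM_1\dots M_m\to_{h\beta_v}VN'M_1\dots M_m$ for every value $V$ and $m\ge0$. Head $\sigma$-reduction $\to_{h\sigma}$ is the least relation such that: $(\lambda x.M)NLM_1\dots M_m\to_{h\sigma}(\lambda x.ML)NM_1\dots M_m$ when $x\notin\mathrm{fv}(L)$; $V((\lambda x.L)N)M_1\dots M_m\to_{h\sigma}(\lambda x.VL)NM_1\dots M_m$ for a value $V$ with $x\notin\mathrm{fv}(V)$; and if $N\to_{h\sigma}N'$ then $VNM_1\dots M_m\to_{h\sigma}VN'M_1\dots M_m$ for every value $V$ ($m\ge 0$ throughout). Head $\mathsf v$-reduction is $\to_h=\to_{h\beta_v}\cup\to_{h\sigma}$, and internal $\mathsf v$-reduction is $\to_{int}=\to_{\mathsf v}\setminus\to_h$ (the pairs in $\to_{\mathsf v}$ not in $\to_h$). -}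

module Defs where

open import Data.Nat using (ℕ; zero; suc; _+_; compare; less; equal; greater)
open import Data.List using (List; []; _∷_; foldl)
open import Data.Product using (_×_)
open import Relation.Nullary using (¬_)
open import Relation.Binary.Construct.Closure.ReflexiveTransitive using (Star)

-- Terms of the call-by-value λ-calculus, up to α-conversion:
-- nameless (de Bruijn) representation.
data Term : Set where
  var : ℕ → Term
  lam : Term → Term
  app : Term → Term → Term

data Value : Term → Set where
  var : ∀ n → Value (var n)
  lam : ∀ M → Value (lam M)

shiftVar : ℕ → ℕ → ℕ
shiftVar zero    i       = suc i
shiftVar (suc c) zero    = zero
shiftVar (suc c) (suc i) = suc (shiftVar c i)

shift : ℕ → Term → Term
shift c (var i)   = var (shiftVar c i)
shift c (lam M)   = lam (shift (suc c) M)
shift c (app M N) = app (shift c M) (shift c N)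

wk : Term → Term
wk = shift 0

-- subst j V M : replace index j by V (V already lives under the j binders
-- crossed), decrementing the free indices above j.  M{V/x} = subst 0 V M.
substVar : ℕ → Term → ℕ → Term
substVar j V i with compare i j
... | less m k    = var m
... | equal m     = V
... | greater m k = var (m + k)

subst : ℕ → Term → Term → Term
subst j V (var i)   = substVar j V i
subst j V (lam M)   = lam (subst (suc j) (wk V) M)
subst j V (app M N) = app (subst j V M) (subst j V N)

_[_] : Term → Term → Term
M [ V ] = subst 0 V M

apps : Term → List Term → Term
apps = foldl app

data _↦βv_ : Term → Term → Set where
  βv : ∀ M V → Value V → app (lam M) V ↦βv (M [ V ])

-- x ∉ fv(L) / x ∉ fv(V) is built in: L (resp. V) is weakened under the binder.
data _↦σ_ : Term → Term → Set where
  σ₁ : ∀ M N L → app (app (lam M) N) L ↦σ app (lam (app M (wk L))) N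
  σ₃ : ∀ V L N → Value V →
       app V (app (lam L) N) ↦σ app (lam (app (wk V) L)) N

data _↦v_ : Term → Term → Set where
  β : ∀ {M N} → M ↦βv N → M ↦v N
  σ : ∀ {M N} → M ↦σ N → M ↦v N

data Ctx (R : Term → Term → Set) : Term → Term → Set where
  root : ∀ {M N} → R M N → Ctx R M N
  lamC : ∀ {M N} → Ctx R M N → Ctx R (lam M) (lam N)
  appL : ∀ {M N} L → Ctx R M N → Ctx R (app M L) (app N L)
  appR : ∀ {M N} L → Ctx R M N → Ctx R (app L M) (app L N)

_→v_ : Term → Term → Set
_→v_ = Ctx _↦v_

data _→hβv_ : Term → Term → Set where
  hβ   : ∀ M V Ms → Value V →
         apps (app (lam M) V) Ms →hβv apps (M [ V ]) Ms
  hctx : ∀ V {N N'} Ms → Value V → N →hβv N' →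
         apps (app V N) Ms →hβv apps (app V N') Ms

data _→hσ_ : Term → Term → Set where
  hσ₁  : ∀ M N L Ms →
         apps (app (app (lam M) N) L) Ms →hσ apps (app (lam (app M (wk L))) N) Ms
  hσ₃  : ∀ V L N Ms → Value V →
         apps (app V (app (lam L) N)) Ms →hσ apps (app (lam (app (wk V) L)) N) Ms
  hctx : ∀ V {N N'} Ms → Value V → N →hσ N' →
         apps (app V N) Ms →hσ apps (app V N') Ms

data _→h_ : Term → Term → Set where
  hβv : ∀ {M N} → M →hβv N → M →h N
  hσ  : ∀ {M N} → M →hσ N → M →h N

_→int_ : Term → Term → Set
M →int N = (M →v N) × ¬ (M →h N)

{-# OPTIONS --safe #-}
-- A relation _st_ in the style of Kashima (head steps first, then independently
-- inside the immediate subterms) is closed under →v on the right, so M →v* M'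
-- gives M st M'; and head σ-steps can be postponed after head βv-steps.  What
-- remains is to split M st M' into head steps followed by internal steps.
--
-- Since →int is a set difference, contracting a redex that is not in head
-- position may fail to be an internal step: (λx.(λy.P)x)V reduces to (λy.P)V both
-- by its head redex and, when x ∉ fv(P), by its inner redex.  Up to loops M → M,
-- such a coincidence occurs only for (λx.X)V → (λx.Y)V with X{V/x} = (λx.Y)V.
-- When it occurs along A st A', the head reduction (λx.A)V → A{V/x} →h* (λx.Q)V
-- leads to some Q st A' with a strictly smaller derivation, which is the
-- termination argument for removing coincidences.
module Submission where

open import Defs
open import Data.List using ([]; _∷_; _∷ʳ_)
open import Data.List.Properties using (foldl-∷ʳ)
open import Data.Nat using (ℕ; zero; suc; _+_; _<_; s≤s; compare; less; equal; greater)
open import Data.Nat.Properties using (≤-refl; ≤-reflexive; ≤-trans; m≤m+n; m≤n+m; +-assoc; +-monoˡ-≤; <-irrefl; suc-injective)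
import Data.Nat.Properties as ℕ
open import Data.Product using (∃-syntax; _×_; _,_; proj₁; proj₂)
open import Data.Sum using (_⊎_; inj₁; inj₂)
open import Function using (_∘_)
open import Relation.Nullary using (¬_; Dec; yes; no; contradiction)
open import Relation.Nullary.Decidable using (map′; _×-dec_)
open import Relation.Binary.PropositionalEquality using (_≡_; refl; sym; trans; cong; cong₂; subst₂; module ≡-Reasoning)
open import Relation.Binary.Construct.Closure.ReflexiveTransitive using (Star; ε; _◅_; _◅◅_; gmap; map; kleisliStar)

-- Terms

app-injective : ∀ {M N M' N'} → app M N ≡ app M' N' → M ≡ M' × N ≡ N'
app-injective refl = refl , refl

lam-injective : ∀ {M M'} → Term.lam M ≡ lam M' → M ≡ M'
lam-injective refl = refl

_≟_ : (M N : Term) → Dec (M ≡ N)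
var i   ≟ var j     = map′ (cong var) (λ { refl → refl }) (i ℕ.≟ j)
var _   ≟ lam _     = no λ ()
var _   ≟ app _ _   = no λ ()
lam _   ≟ var _     = no λ ()
lam M   ≟ lam N     = map′ (cong lam) lam-injective (M ≟ N)
lam _   ≟ app _ _   = no λ ()
app _ _ ≟ var _     = no λ ()
app _ _ ≟ lam _     = no λ ()
app M N ≟ app M' N' =
  map′ (λ (p , q) → cong₂ app p q) app-injective ((M ≟ M') ×-dec (N ≟ N'))

value? : ∀ M → Value M ⊎ (∃[ F ] ∃[ B ] M ≡ app F B)
value? (var i)   = inj₁ (var i)
value? (lam M)   = inj₁ (lam M)
value? (app F B) = inj₂ (F , B , refl)

termSize : Term → ℕ
termSize (var i)   = 0
termSize (lam M)   = suc (termSize M)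
termSize (app M N) = termSize M + termSize N

termSize-shift : ∀ c M → termSize (shift c M) ≡ termSize M
termSize-shift c (var i)   = refl
termSize-shift c (lam M)   = cong suc (termSize-shift (suc c) M)
termSize-shift c (app M N) = cong₂ _+_ (termSize-shift c M) (termSize-shift c N)

-- The right-hand side has at least one abstraction more than `M`. This excludes a σ₃-contraction
-- that leaves its function unchanged.
not-own-wk-body : ∀ {M L} → ¬ M ≡ lam (app (wk M) L)
not-own-wk-body {M} {L} eq = <-irrefl (cong termSize eq)
  (s≤s (≤-trans (≤-reflexive (sym (termSize-shift 0 M))) (m≤m+n _ _)))

-- Renamings and simultaneous substitutions

ext : (ℕ → ℕ) → ℕ → ℕ
ext ρ zero    = zero
ext ρ (suc i) = suc (ρ i)

ren : (ℕ → ℕ) → Term → Term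
ren ρ (var i)   = var (ρ i)
ren ρ (lam M)   = lam (ren (ext ρ) M)
ren ρ (app M N) = app (ren ρ M) (ren ρ N)

exts : (ℕ → Term) → ℕ → Term
exts τ zero    = var zero
exts τ (suc i) = wk (τ i)

-- Simultaneous substitutions compose, so the commutation laws are proved for them and carried over
-- to `subst` by `subst≡sub`.
sub : (ℕ → Term) → Term → Term
sub τ (var i)   = τ i
sub τ (lam M)   = lam (sub (exts τ) M)
sub τ (app M N) = app (sub τ M) (sub τ N)

ren-cong : ∀ {ρ ρ'} → (∀ i → ρ i ≡ ρ' i) → ∀ M → ren ρ M ≡ ren ρ' M
ren-cong e (var i)   = cong var (e i)
ren-cong e (lam M)   = cong lam (ren-cong (λ { zero → refl ; (suc i) → cong suc (e i) }) M)
ren-cong e (app M N) = cong₂ app (ren-cong e M) (ren-cong e N)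

sub-cong : ∀ {τ τ'} → (∀ i → τ i ≡ τ' i) → ∀ M → sub τ M ≡ sub τ' M
sub-cong e (var i)   = e i
sub-cong e (lam M)   = cong lam (sub-cong (λ { zero → refl ; (suc i) → cong wk (e i) }) M)
sub-cong e (app M N) = cong₂ app (sub-cong e M) (sub-cong e N)

shift≡ren : ∀ c M → shift c M ≡ ren (shiftVar c) M
shift≡ren c (var i)   = refl
shift≡ren c (lam M)   = cong lam (trans (shift≡ren (suc c) M)
  (ren-cong (λ { zero → refl ; (suc i) → refl }) M))
shift≡ren c (app M N) = cong₂ app (shift≡ren c M) (shift≡ren c N)

wk≡ren : ∀ M → wk M ≡ ren suc M
wk≡ren M = shift≡ren 0 M

substVar-exts : ∀ j V i → substVar (suc j) (wk V) i ≡ exts (substVar j V) i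
substVar-exts j V zero = refl
substVar-exts j V (suc i) with compare i j
... | less m k    = refl
... | equal m     = refl
... | greater m k = refl

subst≡sub : ∀ j V M → subst j V M ≡ sub (substVar j V) M
subst≡sub j V (var i)   = refl
subst≡sub j V (lam M)   = cong lam (trans (subst≡sub (suc j) (wk V) M)
  (sub-cong (substVar-exts j V) M))
subst≡sub j V (app M N) = cong₂ app (subst≡sub j V M) (subst≡sub j V N)

ren-ren : ∀ ρ ρ' M → ren ρ (ren ρ' M) ≡ ren (ρ ∘ ρ') M
ren-ren ρ ρ' (var i)   = refl
ren-ren ρ ρ' (lam M)   = cong lam (trans (ren-ren (ext ρ) (ext ρ') M)
  (ren-cong (λ { zero → refl ; (suc i) → refl }) M))
ren-ren ρ ρ' (app M N) = cong₂ app (ren-ren ρ ρ' M) (ren-ren ρ ρ' N)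

ren-wk : ∀ ρ M → ren (ext ρ) (wk M) ≡ wk (ren ρ M)
ren-wk ρ M = begin
  ren (ext ρ) (wk M)      ≡⟨ cong (ren (ext ρ)) (wk≡ren M) ⟩
  ren (ext ρ) (ren suc M) ≡⟨ ren-ren (ext ρ) suc M ⟩
  ren (suc ∘ ρ) M         ≡⟨ ren-ren suc ρ M ⟨
  ren suc (ren ρ M)       ≡⟨ wk≡ren (ren ρ M) ⟨
  wk (ren ρ M)            ∎
  where open ≡-Reasoning

wk-shift : ∀ c M → wk (shift c M) ≡ shift (suc c) (wk M)
wk-shift c M = begin
  wk (shift c M)              ≡⟨ cong wk (shift≡ren c M) ⟩
  wk (ren (shiftVar c) M)     ≡⟨ ren-wk (shiftVar c) M ⟨
  ren (ext (shiftVar c)) (wk M) ≡⟨ ren-cong (λ { zero → refl ; (suc i) → refl }) (wk M) ⟩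
  ren (shiftVar (suc c)) (wk M) ≡⟨ shift≡ren (suc c) (wk M) ⟨
  shift (suc c) (wk M)        ∎
  where open ≡-Reasoning

sub-ren : ∀ τ ρ M → sub τ (ren ρ M) ≡ sub (τ ∘ ρ) M
sub-ren τ ρ (var i)   = refl
sub-ren τ ρ (lam M)   = cong lam (trans (sub-ren (exts τ) (ext ρ) M)
  (sub-cong (λ { zero → refl ; (suc i) → refl }) M))
sub-ren τ ρ (app M N) = cong₂ app (sub-ren τ ρ M) (sub-ren τ ρ N)

ren-sub : ∀ ρ τ M → ren ρ (sub τ M) ≡ sub (ren ρ ∘ τ) M
ren-sub ρ τ (var i)   = refl
ren-sub ρ τ (lam M)   = cong lam (trans (ren-sub (ext ρ) (exts τ) M)
  (sub-cong (λ { zero → refl ; (suc i) → ren-wk ρ (τ i) }) M))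
ren-sub ρ τ (app M N) = cong₂ app (ren-sub ρ τ M) (ren-sub ρ τ N)

sub-after-wk : ∀ τ M → sub τ (wk M) ≡ sub (τ ∘ suc) M
sub-after-wk τ M = trans (cong (sub τ) (wk≡ren M)) (sub-ren τ suc M)

sub-wk : ∀ τ M → sub (exts τ) (wk M) ≡ wk (sub τ M)
sub-wk τ M = begin
  sub (exts τ) (wk M)   ≡⟨ sub-after-wk (exts τ) M ⟩
  sub (wk ∘ τ) M        ≡⟨ sub-cong (λ i → wk≡ren (τ i)) M ⟩
  sub (ren suc ∘ τ) M   ≡⟨ ren-sub suc τ M ⟨
  ren suc (sub τ M)     ≡⟨ wk≡ren (sub τ M) ⟨
  wk (sub τ M)          ∎
  where open ≡-Reasoning

sub-sub : ∀ τ τ' M → sub τ (sub τ' M) ≡ sub (sub τ ∘ τ') M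
sub-sub τ τ' (var i)   = refl
sub-sub τ τ' (lam M)   = cong lam (trans (sub-sub (exts τ) (exts τ') M)
  (sub-cong (λ { zero → refl ; (suc i) → sub-wk τ (τ' i) }) M))
sub-sub τ τ' (app M N) = cong₂ app (sub-sub τ τ' M) (sub-sub τ τ' N)

sub-var : ∀ M → sub var M ≡ M
sub-var (var i)   = refl
sub-var (lam M)   = cong lam (trans (sub-cong (λ { zero → refl ; (suc i) → refl }) M) (sub-var M))
sub-var (app M N) = cong₂ app (sub-var M) (sub-var N)

sub-[] : ∀ τ M V → sub τ (M [ V ]) ≡ sub (exts τ) M [ sub τ V ]
sub-[] τ M V = begin
  sub τ (M [ V ])                                ≡⟨ cong (sub τ) (subst≡sub 0 V M) ⟩
  sub τ (sub (substVar 0 V) M)                   ≡⟨ sub-sub τ (substVar 0 V) M ⟩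
  sub (sub τ ∘ substVar 0 V) M                   ≡⟨ sub-cong pointwise M ⟩
  sub (sub (substVar 0 (sub τ V)) ∘ exts τ) M    ≡⟨ sub-sub (substVar 0 (sub τ V)) (exts τ) M ⟨
  sub (substVar 0 (sub τ V)) (sub (exts τ) M)    ≡⟨ subst≡sub 0 (sub τ V) (sub (exts τ) M) ⟨
  sub (exts τ) M [ sub τ V ]                     ∎
  where
  open ≡-Reasoning
  pointwise : ∀ i → sub τ (substVar 0 V i) ≡ sub (substVar 0 (sub τ V)) (exts τ i)
  pointwise zero    = refl
  pointwise (suc i) = sym (trans (sub-after-wk (substVar 0 (sub τ V)) (τ i)) (sub-var (τ i)))

value-shift : ∀ c {V} → Value V → Value (shift c V)
value-shift c (var i) = var _
value-shift c (lam M) = lam _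

value-exts : ∀ {τ} → (∀ i → Value (τ i)) → ∀ i → Value (exts τ i)
value-exts v zero    = var zero
value-exts v (suc i) = value-shift 0 (v i)

value-sub : ∀ {τ} → (∀ i → Value (τ i)) → ∀ {V} → Value V → Value (sub τ V)
value-sub v (var i) = v i
value-sub v (lam M) = lam _

value-substVar : ∀ j {V} → Value V → ∀ i → Value (substVar j V i)
value-substVar j v i with compare i j
... | less m k    = var m
... | equal m     = v
... | greater m k = var (m + k)

substVar-lam : ∀ j V i {W} → substVar j V i ≡ lam W → i ≡ j × V ≡ lam W
substVar-lam j V i eq with compare i j
substVar-lam j V i ()   | less m k
substVar-lam j V i eq   | equal m     = refl , eq
substVar-lam j V i ()   | greater m k

-- Head reduction as closure under weak evaluation contexts

-- `left` adds trailing arguments one at a time, so matching on a head step never has to invert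
-- `apps`.
data Head (R : Term → Term → Set) : Term → Term → Set where
  root  : ∀ {M N} → R M N → Head R M N
  left  : ∀ {M N} L → Head R M N → Head R (app M L) (app N L)
  right : ∀ {V M N} → Value V → Head R M N → Head R (app V M) (app V N)

_⇀_ : Term → Term → Set
_⇀_ = Head _↦v_

head-apps : ∀ {R M N} Ms → Head R M N → Head R (apps M Ms) (apps N Ms)
head-apps []       h = h
head-apps (L ∷ Ms) h = head-apps Ms (left L h)

head-map : ∀ {R S : Term → Term → Set} → (∀ {M N} → R M N → S M N) →
           ∀ {M N} → Head R M N → Head S M N
head-map f (root r)    = root (f r)
head-map f (left L h)  = left L (head-map f h)
head-map f (right v h) = right v (head-map f h)

→hβv⇒head : ∀ {M N} → M →hβv N → Head _↦βv_ M N
→hβv⇒head (hβ M V Ms v)     = head-apps Ms (root (βv M V v))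
→hβv⇒head (hctx V Ms v h)   = head-apps Ms (right v (→hβv⇒head h))

→hσ⇒head : ∀ {M N} → M →hσ N → Head _↦σ_ M N
→hσ⇒head (hσ₁ M N L Ms)     = head-apps Ms (root (σ₁ M N L))
→hσ⇒head (hσ₃ V L N Ms v)   = head-apps Ms (root (σ₃ V L N v))
→hσ⇒head (hctx V Ms v h)    = head-apps Ms (right v (→hσ⇒head h))

→h⇒head : ∀ {M N} → M →h N → M ⇀ N
→h⇒head (hβv h) = head-map β (→hβv⇒head h)
→h⇒head (hσ h)  = head-map σ (→hσ⇒head h)

→hβv-left : ∀ {M N} L → M →hβv N → app M L →hβv app N L
→hβv-left L (hβ M V Ms v) =
  subst₂ _→hβv_ (foldl-∷ʳ app _ L Ms) (foldl-∷ʳ app _ L Ms) (hβ M V (Ms ∷ʳ L) v)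
→hβv-left L (hctx V Ms v h) =
  subst₂ _→hβv_ (foldl-∷ʳ app _ L Ms) (foldl-∷ʳ app _ L Ms) (hctx V (Ms ∷ʳ L) v h)

→hσ-left : ∀ {M N} L → M →hσ N → app M L →hσ app N L
→hσ-left K (hσ₁ M N L Ms) =
  subst₂ _→hσ_ (foldl-∷ʳ app _ K Ms) (foldl-∷ʳ app _ K Ms) (hσ₁ M N L (Ms ∷ʳ K))
→hσ-left K (hσ₃ V L N Ms v) =
  subst₂ _→hσ_ (foldl-∷ʳ app _ K Ms) (foldl-∷ʳ app _ K Ms) (hσ₃ V L N (Ms ∷ʳ K) v)
→hσ-left K (hctx V Ms v h) =
  subst₂ _→hσ_ (foldl-∷ʳ app _ K Ms) (foldl-∷ʳ app _ K Ms) (hctx V (Ms ∷ʳ K) v h)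

head⇒→hβv : ∀ {M N} → Head _↦βv_ M N → M →hβv N
head⇒→hβv (root (βv M V v)) = hβ M V [] v
head⇒→hβv (left L h)        = →hβv-left L (head⇒→hβv h)
head⇒→hβv (right v h)       = hctx _ [] v (head⇒→hβv h)

head⇒→hσ : ∀ {M N} → Head _↦σ_ M N → M →hσ N
head⇒→hσ (root (σ₁ M N L))   = hσ₁ M N L []
head⇒→hσ (root (σ₃ V L N v)) = hσ₃ V L N [] v
head⇒→hσ (left L h)          = →hσ-left L (head⇒→hσ h)
head⇒→hσ (right v h)         = hctx _ [] v (head⇒→hσ h)

head-split : ∀ {M N} → M ⇀ N → Head _↦βv_ M N ⊎ Head _↦σ_ M N
head-split (root (β r)) = inj₁ (root r)
head-split (root (σ r)) = inj₂ (root r)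
head-split (left L h) with head-split h
... | inj₁ h' = inj₁ (left L h')
... | inj₂ h' = inj₂ (left L h')
head-split (right v h) with head-split h
... | inj₁ h' = inj₁ (right v h')
... | inj₂ h' = inj₂ (right v h')

head⇒→h : ∀ {M N} → M ⇀ N → M →h N
head⇒→h h with head-split h
... | inj₁ h' = hβv (head⇒→hβv h')
... | inj₂ h' = hσ (head⇒→hσ h')

head⇒→v : ∀ {M N} → M ⇀ N → M →v N
head⇒→v (root r)    = root r
head⇒→v (left L h)  = appL L (head⇒→v h)
head⇒→v (right v h) = appR _ (head⇒→v h)

value-head-normal : ∀ {V N} → Value V → ¬ V ⇀ N
value-head-normal (var i) (root (β ()))
value-head-normal (var i) (root (σ ()))
value-head-normal (lam M) (root (β ()))
value-head-normal (lam M) (root (σ ()))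

head-sub : ∀ {τ} → (∀ i → Value (τ i)) → ∀ {M N} → M ⇀ N → sub τ M ⇀ sub τ N
head-sub {τ} vs (root (β (βv M V v))) rewrite sub-[] τ M V =
  root (β (βv _ _ (value-sub vs v)))
head-sub {τ} vs (root (σ (σ₁ M N L))) rewrite sub-wk τ L = root (σ (σ₁ _ _ _))
head-sub {τ} vs (root (σ (σ₃ V L N v))) rewrite sub-wk τ V =
  root (σ (σ₃ _ _ _ (value-sub vs v)))
head-sub vs (left L h)  = left _ (head-sub vs h)
head-sub vs (right v h) = right (value-sub vs v) (head-sub vs h)

head-subst : ∀ j {V} → Value V → ∀ {M N} → M ⇀ N → subst j V M ⇀ subst j V N
head-subst j {V} v {M} {N} h rewrite subst≡sub j V M | subst≡sub j V N =
  head-sub (value-substVar j v) h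

-- Postponement of head σ-steps

wk-[] : ∀ M V → wk M [ V ] ≡ M
wk-[] M V = trans (subst≡sub 0 V (wk M)) (trans (sub-after-wk (substVar 0 V) M) (sub-var M))

σ-result-nonvalue : ∀ {M N} → Head _↦σ_ M N → ¬ Value N
σ-result-nonvalue (root (σ₁ M N L)) ()
σ-result-nonvalue (root (σ₃ V L N v)) ()
σ-result-nonvalue (left L h) ()
σ-result-nonvalue (right v h) ()

value-βv-normal : ∀ {V N} → Value V → ¬ Head _↦βv_ V N
value-βv-normal v h = value-head-normal v (head-map β h)

-- σ only regroups applications around an existing redex, so the βv-redex contracted afterwards was
-- already in head position. The σ-step follows it, or vanishes when the redex it moved outwards is
-- the one contracted.
σ-βv-swap : ∀ {M N L} → Head _↦σ_ M N → Head _↦βv_ N L →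
            ∃[ K ] (Head _↦βv_ M K × Star (Head _↦σ_) K L)
σ-βv-swap (root (σ₁ M N L)) (root (βv _ _ v)) rewrite wk-[] L N =
  _ , left L (root (βv M N v)) , ε
σ-βv-swap (root (σ₁ M N L)) (left _ k) = contradiction k (value-βv-normal (lam _))
σ-βv-swap (root (σ₁ M N L)) (right _ k) =
  _ , left L (right (lam M) k) , root (σ₁ _ _ _) ◅ ε
σ-βv-swap (root (σ₃ V L N v)) (root (βv _ _ w)) rewrite wk-[] V N =
  _ , right v (root (βv L N w)) , ε
σ-βv-swap (root (σ₃ V L N v)) (left _ k) = contradiction k (value-βv-normal (lam _))
σ-βv-swap (root (σ₃ V L N v)) (right _ k) =
  _ , right v (right (lam L) k) , root (σ₃ _ _ _ v) ◅ ε
σ-βv-swap (left L h) (root (βv M V v)) = contradiction (lam M) (σ-result-nonvalue h)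
σ-βv-swap (left L h) (left _ k) with σ-βv-swap h k
... | _ , k' , hs = _ , left L k' , gmap (λ M → app M L) (left L) hs
σ-βv-swap (left L h) (right v k) = contradiction v (σ-result-nonvalue h)
σ-βv-swap (right v h) (root (βv M V w)) = contradiction w (σ-result-nonvalue h)
σ-βv-swap (right v h) (left _ k) = contradiction k (value-βv-normal v)
σ-βv-swap (right v h) (right _ k) with σ-βv-swap h k
... | _ , k' , hs = _ , right v k' , gmap (app _) (right v) hs

σ*-βv-swap : ∀ {M N L} → Star (Head _↦σ_) M N → Head _↦βv_ N L →
             ∃[ K ] (Head _↦βv_ M K × Star (Head _↦σ_) K L)
σ*-βv-swap ε k = _ , k , ε
σ*-βv-swap (h ◅ hs) k with σ*-βv-swap hs k
... | _ , k₁ , hs₁ with σ-βv-swap h k₁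
... | _ , k₂ , hs₂ = _ , k₂ , hs₂ ◅◅ hs₁

σ*-βv*-swap : ∀ {M N L} → Star (Head _↦σ_) M N → Star (Head _↦βv_) N L →
              ∃[ K ] (Star (Head _↦βv_) M K × Star (Head _↦σ_) K L)
σ*-βv*-swap hs ε = _ , ε , hs
σ*-βv*-swap hs (k ◅ ks) with σ*-βv-swap hs k
... | _ , k₁ , hs₁ with σ*-βv*-swap hs₁ ks
... | _ , ks₂ , hs₂ = _ , k₁ ◅ ks₂ , hs₂

postpone-σ : ∀ {M N} → Star _⇀_ M N →
             ∃[ L ] (Star (Head _↦βv_) M L × Star (Head _↦σ_) L N)
postpone-σ ε = _ , ε , ε
postpone-σ (h ◅ hs) with head-split h | postpone-σ hs
... | inj₁ k | _ , ks , ls = _ , k ◅ ks , ls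
... | inj₂ l | _ , ks , ls with σ*-βv*-swap (l ◅ ε) ks
... | _ , ks' , ls' = _ , ks' , ls' ◅◅ ls

-- Standard reduction

infix 4 _st_

data _st_ : Term → Term → Set where
  step : ∀ {M N M'} → M ⇀ N → N st M' → M st M'
  var  : ∀ i → var i st var i
  lam  : ∀ {A A'} → A st A' → lam A st lam A'
  app  : ∀ {F F' B B'} → F st F' → B st B' → app F B st app F' B'

-- Counts the head steps at all depths of a derivation; this is the measure that a coincidence
-- lowers.
size : ∀ {M M'} → M st M' → ℕ
size (step h d)  = suc (size d)
size (var i)     = 0
size (lam d)     = size d
size (app d e)   = size d + size e

length : ∀ {M N} → Star _⇀_ M N → ℕ
length ε        = 0
length (h ◅ hs) = suc (length hs)

prepend : ∀ {M N M'} → Star _⇀_ M N → N st M' → M st M'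
prepend ε        d = d
prepend (h ◅ hs) d = step h (prepend hs d)

size-prepend : ∀ {M N M'} (hs : Star _⇀_ M N) (d : N st M') →
               size (prepend hs d) ≡ length hs + size d
size-prepend ε        d = refl
size-prepend (h ◅ hs) d = cong suc (size-prepend hs d)

st-refl : ∀ {M} → M st M
st-refl {var i}   = var i
st-refl {lam M}   = lam st-refl
st-refl {app M N} = app st-refl st-refl

-- Head steps at the root precede the structural rule, which then fixes the shape of the term
-- reached.
st-lam⁻¹ : ∀ {M A'} → M st lam A' → ∃[ A ] (Star _⇀_ M (lam A) × A st A')
st-lam⁻¹ (lam d) = _ , ε , d
st-lam⁻¹ (step h d) with st-lam⁻¹ d
... | _ , hs , e = _ , h ◅ hs , e

st-app⁻¹ : ∀ {M F' B'} → M st app F' B' →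
           ∃[ F ] ∃[ B ] (Star _⇀_ M (app F B) × F st F' × B st B')
st-app⁻¹ (app d e) = _ , _ , ε , d , e
st-app⁻¹ (step h d) with st-app⁻¹ d
... | _ , _ , hs , e , f = _ , _ , h ◅ hs , e , f

st-value⁻¹ : ∀ {M V'} → Value V' → M st V' → ∃[ V ] (Value V × Star _⇀_ M V × V st V')
st-value⁻¹ v (step h d) with st-value⁻¹ v d
... | _ , w , hs , e = _ , w , h ◅ hs , e
st-value⁻¹ v (var i) = _ , var i , ε , var i
st-value⁻¹ v (lam d) = _ , lam _ , ε , lam d

-- Treated before `st-sub` because weakening, an instance, is used there under binders.
st-sub-same : ∀ {τ} → (∀ i → Value (τ i)) → ∀ {M M'} → M st M' → sub τ M st sub τ M'
st-sub-same vs (step h d) = step (head-sub vs h) (st-sub-same vs d)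
st-sub-same vs (var i)    = st-refl
st-sub-same vs (lam d)    = lam (st-sub-same (value-exts vs) d)
st-sub-same vs (app d e)  = app (st-sub-same vs d) (st-sub-same vs e)

wk≡sub : ∀ M → wk M ≡ sub (λ i → var (suc i)) M
wk≡sub M = trans (sym (sub-var (wk M))) (sub-after-wk var M)

st-wk : ∀ {M M'} → M st M' → wk M st wk M'
st-wk {M} {M'} d rewrite wk≡sub M | wk≡sub M' = st-sub-same (λ i → var (suc i)) d

st-sub : ∀ {τ τ'} → (∀ i → Value (τ i)) → (∀ i → τ i st τ' i) →
         ∀ {M M'} → M st M' → sub τ M st sub τ' M'
st-sub vs ds (step h d) = step (head-sub vs h) (st-sub vs ds d)
st-sub vs ds (var i)    = ds i
st-sub vs ds (lam d)    =
  lam (st-sub (value-exts vs) (λ { zero → var 0 ; (suc i) → st-wk (ds i) }) d)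
st-sub vs ds (app d e)  = app (st-sub vs ds d) (st-sub vs ds e)

st-[] : ∀ {M M' V V'} → Value V → M st M' → V st V' → M [ V ] st M' [ V' ]
st-[] {M} {M'} {V} {V'} v d e rewrite subst≡sub 0 V M | subst≡sub 0 V' M' =
  st-sub (value-substVar 0 v) (λ { zero → e ; (suc i) → var i }) d

left* : ∀ {M N} L → Star _⇀_ M N → Star _⇀_ (app M L) (app N L)
left* L = gmap (λ M → app M L) (left L)

right* : ∀ {V M N} → Value V → Star _⇀_ M N → Star _⇀_ (app V M) (app V N)
right* v = gmap (app _) (right v)

-- Inverting the derivation, head steps bring `M` to a redex of the same kind as `N`, at the root.
-- Contracting it is one more head step, and the derivations of its parts recombine.
st-root : ∀ {M N N'} → M st N → N ↦v N' → M st N'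
st-root d (β (βv A' V' v')) =
  let _ , B , hs , dF , dB = st-app⁻¹ d
      A , fs , dA          = st-lam⁻¹ dF
      V , v , bs , dV      = st-value⁻¹ v' dB
  in prepend (hs ◅◅ left* B fs ◅◅ right* (lam A) bs)
       (step (root (β (βv A V v))) (st-[] v dA dV))
st-root d (σ (σ₁ A' B' L')) =
  let _ , L , hs , dF , dL = st-app⁻¹ d
      _ , B , fs , dG , dB = st-app⁻¹ dF
      A , gs , dA          = st-lam⁻¹ dG
  in prepend (hs ◅◅ left* L (fs ◅◅ left* B gs))
       (step (root (σ (σ₁ A B L))) (app (lam (app dA (st-wk dL))) dB))
st-root d (σ (σ₃ V' L' N' v')) =
  let _ , B , hs , dF , dB = st-app⁻¹ d
      V , v , fs , dV      = st-value⁻¹ v' dF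
      _ , N , bs , dG , dN = st-app⁻¹ dB
      L , gs , dL          = st-lam⁻¹ dG
  in prepend (hs ◅◅ left* B fs ◅◅ right* v (bs ◅◅ left* N gs))
       (step (root (σ (σ₃ V L N v))) (app (lam (app (st-wk dV) dL)) dN))

st-→v : ∀ {M N N'} → M st N → N →v N' → M st N'
st-→v d (root r) = st-root d r
st-→v d (lamC s) =
  let _ , hs , e = st-lam⁻¹ d in prepend hs (lam (st-→v e s))
st-→v d (appL _ s) =
  let _ , _ , hs , e , f = st-app⁻¹ d in prepend hs (app (st-→v e s) f)
st-→v d (appR _ s) =
  let _ , _ , hs , e , f = st-app⁻¹ d in prepend hs (app e (st-→v f s))

st-→v* : ∀ {M N N'} → M st N → Star _→v_ N N' → M st N'
st-→v* d ε        = d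
st-→v* d (s ◅ ss) = st-→v* (st-→v d s) ss


st⇒→v* : ∀ {M M'} → M st M' → Star _→v_ M M'
st⇒→v* (step h d) = head⇒→v h ◅ st⇒→v* d
st⇒→v* (var i)    = ε
st⇒→v* (lam d)    = gmap lam lamC (st⇒→v* d)
st⇒→v* (app {F} {F'} {B} d e) =
  gmap (λ X → app X B) (appL B) (st⇒→v* d) ◅◅ gmap (app F') (appR F') (st⇒→v* e)

-- Coincidences of head and non-head steps

-- Shifting at `k` leaves no free index `k`, which is `suc k` under the abstraction.
shift-avoids : ∀ k V Z → ¬ shift k V ≡ lam (app (var (suc k)) Z)
shift-avoids k (lam (app (var i) N)) Z eq =
  shiftVar≢ (suc k) i (var-injective (proj₁ (app-injective (lam-injective eq))))
  where
  var-injective : ∀ {i j} → Term.var i ≡ var j → i ≡ j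
  var-injective refl = refl
  shiftVar≢ : ∀ c i → ¬ shiftVar c i ≡ c
  shiftVar≢ zero    i       ()
  shiftVar≢ (suc c) zero    ()
  shiftVar≢ (suc c) (suc i) eq = shiftVar≢ c i (suc-injective eq)

value≢app : ∀ {V F B} → Value V → ¬ V ≡ app F B
value≢app (var i) ()
value≢app (lam M) ()

-- Descent on `P`, which must be an application whose function instantiates to `lam P`. A variable
-- there would make `shift k V` mention index `k`; an abstraction `lam C` puts `C` in the same
-- situation one binder deeper.
no-self-copy : ∀ k {V} → Value V → ∀ P {Y} → ¬ subst (suc k) (shift k V) P ≡ app (lam P) Y
no-self-copy k v (var i) eq = value≢app (value-substVar (suc k) (value-shift k v) i) eq
no-self-copy k {V} v (app (var i) Z) eq
  with substVar-lam (suc k) (shift k V) i (proj₁ (app-injective eq))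
... | refl , eq' = shift-avoids k V Z eq'
no-self-copy k {V} v (app (lam C) Z) eq
  with lam-injective (proj₁ (app-injective eq))
... | eq' rewrite wk-shift k V = no-self-copy (suc k) (value-shift 0 v) C eq'

substVar-zero : ∀ n W i → substVar (suc n) (lam W) i ≡ var 0 → i ≡ 0
substVar-zero n W zero eq = refl
substVar-zero n W (suc i) eq with compare i n
substVar-zero n W (suc i) () | less m k
substVar-zero n W (suc i) () | equal m
substVar-zero n W (suc i) () | greater m k

-- Infinite descent: E would have to be λx.xE₂ with E₂ in the same situation.
no-lagging-copy : ∀ n W E {E₁} → E →v E₁ → ¬ subst n (lam W) E ≡ lam (app (var 0) E₁)
no-lagging-copy n W (var i) (root (β ())) eq
no-lagging-copy n W (var i) (root (σ ())) eq
no-lagging-copy n W (app F B) s ()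
no-lagging-copy n W (lam T) (root (β ())) eq
no-lagging-copy n W (lam T) (root (σ ())) eq
no-lagging-copy n W (lam (var i)) (lamC (root (β ()))) eq
no-lagging-copy n W (lam (var i)) (lamC (root (σ ()))) eq
no-lagging-copy n W (lam (app (lam C) E)) (lamC s) ()
no-lagging-copy n W (lam (app (app C D) E)) (lamC s) ()
no-lagging-copy n W (lam (app (var i) E)) (lamC (root (β ()))) eq
no-lagging-copy n W (lam (app (var i) .(app (lam L) N))) (lamC (root (σ (σ₃ _ L N v)))) eq
  with () ← proj₂ (app-injective (lam-injective eq))
no-lagging-copy n W (lam (app (var i) E)) (lamC (appL _ (root (β ())))) eq
no-lagging-copy n W (lam (app (var i) E)) (lamC (appL _ (root (σ ())))) eq
no-lagging-copy n W (lam (app (var i) E)) (lamC (appR _ s)) eq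
  with app-injective (lam-injective eq)
... | eqC , eqE with substVar-zero n _ i eqC
... | refl = no-lagging-copy (suc n) _ E s eqE

-- `P` would be an application whose function instantiates to `lam P`. An abstraction there
-- contradicts `no-self-copy`; the bound variable forces `V` to be `lam P`, and comparing arguments
-- leads to `no-lagging-copy`.
no-arg-coincidence : ∀ {V Y} → Value V → V →v Y → ∀ P → ¬ P [ V ] ≡ app (lam P) Y
no-arg-coincidence v s (var i) eq = value≢app (value-substVar 0 v i) eq
no-arg-coincidence v s (app (lam C) Z) eq =
  no-self-copy 0 v C (lam-injective (proj₁ (app-injective eq)))
no-arg-coincidence {V} v s (app (var i) Z) eq
  with app-injective eq
... | eqF , eqB with substVar-lam 0 V i eqF
no-arg-coincidence v (root (β ())) (app (var .0) Z) eq | eqF , eqB | refl , refl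
no-arg-coincidence v (root (σ ())) (app (var .0) Z) eq | eqF , eqB | refl , refl
no-arg-coincidence v (lamC (root (β ()))) (app (var .0) Z) eq | eqF , eqB | refl , refl
no-arg-coincidence v (lamC (root (σ (σ₃ _ L N w)))) (app (var .0) .(app (lam L) N)) eq
  | eqF , () | refl , refl
no-arg-coincidence v (lamC (appL _ (root (β ())))) (app (var .0) Z) eq | eqF , eqB | refl , refl
no-arg-coincidence v (lamC (appL _ (root (σ ())))) (app (var .0) Z) eq | eqF , eqB | refl , refl
no-arg-coincidence v (lamC (appR _ s)) (app (var .0) Z) eq | eqF , eqB | refl , refl =
  no-lagging-copy 0 _ Z s eqB

-- For n = 0 and D = V this says that (λX)V → (λY)V is also a head βv-step.  The
-- general case describes the same situation below n binders of such a term.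
Coincide : ℕ → Term → Term → Term → Term → Set
Coincide n V D X Y = subst n V X ≡ app (lam Y) D

Avoiding : ℕ → Term → Term → Term → Term → Set
Avoiding n V D X Y = X →v Y × ¬ Coincide n V D X Y

-- The situations met on descending into bodies. Below a binder the value is kept as `shift k V`
-- against index `suc k`, the form required by `shift-avoids` and `no-self-copy`.
data Admissible : ℕ → Term → Term → Set where
  top   : ∀ {V} → Admissible 0 V V
  under : ∀ {k V D} → Value V → Admissible (suc k) (shift k V) D

admissible-under : ∀ {n V D} → Value V → Admissible n V D → ∀ B → Admissible (suc n) (wk V) B
admissible-under v top B = under v
admissible-under v (under {k} {V} w) B rewrite wk-shift k V = under (value-shift 0 w)

-- A coincidence would make `F` instantiate to `lam (app F Y)`, which fails for the reasons behind
-- `no-arg-coincidence`; below a binder `shift-avoids` settles the variable case.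
arg-avoiding : ∀ {n V D F X Y} → Value V → Admissible n V D → Value F → X →v Y →
               Avoiding n V D (app F X) (app F Y)
arg-avoiding v a f s = appR _ s , go v a f s
  where
  go : ∀ {n V D F X Y} → Value V → Admissible n V D → Value F → X →v Y →
       ¬ Coincide n V D (app F X) (app F Y)
  go {V = V} v top (var i) s eq with app-injective eq
  ... | eqF , eqX with substVar-lam 0 V i eqF
  -- As `D` is `V`, `X` instantiates to `lam (app (var 0) Y)` while `X →v Y`.
  ... | refl , refl = no-lagging-copy 0 _ _ s eqX
  go v (under {k} {V} w) (var i) s eq
    with substVar-lam (suc k) (shift k V) i (proj₁ (app-injective eq))
  ... | refl , eqV = shift-avoids k V _ eqV
  go v top (lam P) s eq = no-self-copy 0 v P (lam-injective (proj₁ (app-injective eq)))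
  go v (under {k} {V} w) (lam P) s eq with lam-injective (proj₁ (app-injective eq))
  ... | eqP rewrite wk-shift k V = no-self-copy (suc k) (value-shift 0 w) P eqP

args-avoiding : ∀ {n V D F X Y} → Value V → Admissible n V D → Value F → Star _→v_ X Y →
                Star (Avoiding n V D) (app F X) (app F Y)
args-avoiding v a f = gmap (app _) (arg-avoiding v a f)

-- The bound includes the head steps towards (λQ)D because, one level up, they
-- become part of a standard derivation.
Collapse : Term → Term → Term → ℕ → Set
Collapse M D A' m =
  ∃[ Q ] ∃[ hs ] ∃[ d ] (length {M} {app (lam Q) D} hs + size {Q} {A'} d < m)

collapse-now : ∀ {M D Q A' m} → M ≡ app (lam Q) D → (d : Q st A') → size d < m →
               Collapse M D A' m
collapse-now refl d lt = _ , ε , d , lt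

AvoidOrCollapse : ℕ → Term → Term → Term → Term → ℕ → Set
AvoidOrCollapse n V D A A' m = Star (Avoiding n V D) A A' ⊎ Collapse (subst n V A) D A' m

-- A coincidence at `h` is a collapse with `Q = B`, and dropping `h` makes its derivation smaller.
-- Otherwise a later collapse is pulled back along the instance of `h`, which adds one to both sides
-- of the bound.
avoid-step : ∀ {n V D A B A'} → Value V → A ⇀ B → (d : B st A') →
             AvoidOrCollapse n V D B A' (size d) →
             AvoidOrCollapse n V D A A' (suc (size d))
avoid-step {n} {V} {D} {A} {B} v h d r with subst n V A ≟ app (lam B) D
... | yes eq = inj₂ (collapse-now eq d ≤-refl)
avoid-step v h d (inj₁ ss) | no ¬eq = inj₁ ((head⇒→v h , ¬eq) ◅ ss)
avoid-step {n} v h d (inj₂ (Q , hs , e , lt)) | no ¬eq =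
  inj₂ (Q , head-subst n v h ◅ hs , e , s≤s lt)

mutual

  avoid-or-collapse : ∀ {n V D A A'} → Value V → Admissible n V D → (d : A st A') →
                      AvoidOrCollapse n V D A A' (size d)
  avoid-or-collapse v a (step h d) = avoid-step v h d (avoid-or-collapse v a d)
  avoid-or-collapse v a (var i)    = inj₁ ε
  avoid-or-collapse v a (lam d)    = inj₁ (gmap lam (λ s → lamC s , λ ()) (st⇒→v* d))
  avoid-or-collapse v a (app d e)  = avoid-or-collapse-app v a d e

  -- For `lam P` in function position, a coincidence of a body step needs `B` to instantiate to `D`
  -- and `P` to coincide one binder deeper, with `B` in the role of `D`.
  avoid-or-collapse-app : ∀ {n V D F F' B B'} → Value V → Admissible n V D →
                          (d : F st F') (e : B st B') →
                          AvoidOrCollapse n V D (app F B) (app F' B') (size d + size e)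
  avoid-or-collapse-app {B = B} v a (step h d) e =
    avoid-step v (left B h) (app d e) (avoid-or-collapse-app v a d e)
  avoid-or-collapse-app v a (var i) e = inj₁ (args-avoiding v a (var i) (st⇒→v* e))
  -- The function stays an application, so no instance has an abstraction in function position.
  avoid-or-collapse-app {B = B} v a (app {G} {G'} {E} {E'} d₁ d₂) e = inj₁
    (gmap (λ X → app (app X E) B) (λ s → appL B (appL E s) , λ ()) (st⇒→v* d₁) ◅◅
     gmap (λ X → app (app G' X) B) (λ s → appL B (appR G' s) , λ ()) (st⇒→v* d₂) ◅◅
     gmap (λ X → app (app G' E') X) (λ s → appR (app G' E') s , λ ()) (st⇒→v* e))
  avoid-or-collapse-app {n} {V} {D} {B = B} v a (lam {P} {P'} d) e
    with subst n V B ≟ D | avoid-or-collapse (value-shift 0 v) (admissible-under v a B) d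
  ... | no ¬eq | _ = inj₁
    (gmap (λ X → app (lam X) B)
          (λ s → appL B (lamC s) , λ eq → ¬eq (proj₂ (app-injective eq))) (st⇒→v* d) ◅◅
     args-avoiding v a (lam P') (st⇒→v* e))
  ... | yes _ | inj₁ ss = inj₁
    (gmap (λ X → app (lam X) B)
          (λ (s , ¬eq) → appL B (lamC s) ,
                         λ eq → ¬eq (lam-injective (proj₁ (app-injective eq)))) ss ◅◅
     args-avoiding v a (lam P') (st⇒→v* e))
  ... | yes refl | inj₂ (Q , hs , d' , lt) =
    -- The new `Q` is the instantiated body `P`: it head-reduces along `hs` to `app (lam Q) B`,
    -- where `lam d'` and `e` take over.
    inj₂ (collapse-now refl (prepend hs (app (lam d') e)) bound)
    where
    bound : size (prepend hs (app (lam d') e)) < size d + size e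
    bound rewrite size-prepend hs (app (lam d') e)
                | sym (+-assoc (length hs) (size d') (size e)) = +-monoˡ-≤ (size e) lt

-- Internal steps

int : ∀ {M N} → M →v N → ¬ M ⇀ N → M →int N
int s ¬h = s , λ h → ¬h (→h⇒head h)

int-lam : ∀ {A B} → A →v B → lam A →int lam B
int-lam s = int (lamC s) (value-head-normal (lam _))

value-→v : ∀ {V N} → Value V → V →v N → Value N
value-→v (var i) (root (β ()))
value-→v (var i) (root (σ ()))
value-→v (lam M) (root (β ()))
value-→v (lam M) (root (σ ()))
value-→v (lam M) (lamC s) = lam _

-- An application reaches a value only by βv at the root, which is a head step.
int-to-value : ∀ {F B V} → Value V → ¬ app F B →int V
int-to-value v (root (β r) , ¬h)   = ¬h (head⇒→h (root (β r)))
int-to-value () (root (σ (σ₁ _ _ _)) , ¬h)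
int-to-value () (root (σ (σ₃ _ _ _ _)) , ¬h)
int-to-value () (appL _ _ , ¬h)
int-to-value () (appR _ _ , ¬h)

-- A head step on the left is excluded by hypothesis; σ₁ at the root would need `G'` to be an
-- abstraction, against `int-to-value`.
int-left : ∀ {G E G' B} → app G E →int G' → app (app G E) B →int app G' B
int-left {G} {E} {G'} {B} s = int (appL B (proj₁ s)) (λ h → go h refl)
  where
  go : ∀ {T} → app (app G E) B ⇀ T → ¬ T ≡ app G' B
  go (root (β ())) eq
  go (root (σ (σ₁ _ _ _))) refl = int-to-value (lam _) s
  go (root (σ (σ₃ _ _ _ ()))) eq
  go (left _ h) refl = proj₂ s (head⇒→h h)
  go (right () h) eq

value-→int* : ∀ {V N} → Value V → Star _→int_ V N → Value N
value-→int* v ε        = v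
value-→int* v (s ◅ ss) = value-→int* (value-→v v (proj₁ s)) ss

-- Values reduce only to values, so a sequence ending in an application consists of applications.
int-left* : ∀ {G F' E' B} → Star _→int_ G (app F' E') →
            Star _→int_ (app G B) (app (app F' E') B)
int-left* {app _ _} ε        = ε
int-left* {app _ _} (s ◅ ss) = int-left s ◅ int-left* ss
int-left* {var i}   ss = contradiction (value-→int* (var i) ss) λ ()
int-left* {lam A}   ss = contradiction (value-→int* (lam A) ss) λ ()

int-right-value : ∀ {F X Y} → Value F → X →int Y → app F X →int app F Y
int-right-value {F} {X} {Y} f s = int (appR F (proj₁ s)) (λ h → go f s h refl)
  where
  go : ∀ {F X Y T} → Value F → X →int Y → app F X ⇀ T → ¬ T ≡ app F Y
  go f s (root (β (βv P V v))) eq = no-arg-coincidence v (proj₁ s) P eq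
  go () s (root (σ (σ₁ _ _ _))) eq
  go f s (root (σ (σ₃ _ _ _ _))) eq = not-own-wk-body (sym (proj₁ (app-injective eq)))
  go f s (left _ h) eq = value-head-normal f h
  go f s (right _ h) refl = proj₂ s (head⇒→h h)

-- With an application in function position, a head step either acts on it and keeps `X`, or is σ₁
-- and makes the function an abstraction.
int-right-nonvalue : ∀ {F E X Y} → X →v Y → ¬ X ≡ Y → app (app F E) X →int app (app F E) Y
int-right-nonvalue {F} {E} {X} {Y} s X≢Y = int (appR (app F E) s) (λ h → go h refl)
  where
  go : ∀ {T} → app (app F E) X ⇀ T → ¬ T ≡ app (app F E) Y
  go (root (β ())) eq
  go (root (σ (σ₁ _ _ _))) ()
  go (root (σ (σ₃ _ _ _ ()))) eq
  go (left _ h) eq = X≢Y (proj₂ (app-injective eq))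
  go (right () h) eq

int-body-value : ∀ {V X Y} → Value V → Avoiding 0 V V X Y →
                 app (lam X) V →int app (lam Y) V
int-body-value {V} {X} {Y} v (s , ¬eq) = int (appL V (lamC s)) (λ h → go v ¬eq h refl)
  where
  go : ∀ {V X Y T} → Value V → ¬ Coincide 0 V V X Y → app (lam X) V ⇀ T →
       ¬ T ≡ app (lam Y) V
  go v ¬eq (root (β (βv _ _ _))) eq = ¬eq eq
  go () ¬eq (root (σ (σ₃ _ _ _ _))) eq
  go v ¬eq (left _ h) eq = value-head-normal (lam _) h
  go v ¬eq (right _ h) eq = value-head-normal v h

int-body-nonvalue : ∀ {F E X Y} → X →v Y → ¬ X ≡ Y →
                    app (lam X) (app F E) →int app (lam Y) (app F E)
int-body-nonvalue {F} {E} {X} {Y} s X≢Y = int (appL (app F E) (lamC s)) (λ h → go h refl)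
  where
  go : ∀ {T} → app (lam X) (app F E) ⇀ T → ¬ T ≡ app (lam Y) (app F E)
  go (root (β (βv _ _ ()))) eq
  -- σ₃ replaces the argument by its own proper subterm `E`, but the target keeps it whole.
  go (root (σ (σ₃ _ _ _ _))) eq with () ← proj₂ (app-injective eq)
  go (left _ h) eq = value-head-normal (lam _) h
  go (right _ h) eq = X≢Y (lam-injective (proj₁ (app-injective eq)))

-- A loop `X →v X` is dropped, since its image could be a head step; every other step comes with
-- `X ≢ Y`.
skip-loops : ∀ {f : Term → Term} → (∀ {X Y} → X →v Y → ¬ X ≡ Y → f X →int f Y) →
             ∀ {X Y} → Star _→v_ X Y → Star _→int_ (f X) (f Y)
skip-loops {f} g = kleisliStar f one
  where
  one : ∀ {X Y} → X →v Y → Star _→int_ (f X) (f Y)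
  one {X} {Y} s with X ≟ Y
  ... | yes refl = ε
  ... | no X≢Y   = g s X≢Y ◅ ε

-- Factorization

HeadInt : Term → Term → Set
HeadInt M M' = ∃[ N ] (Star _⇀_ M N × Star _→int_ N M')

head-HeadInt : ∀ {M N M'} → Star _⇀_ M N → HeadInt N M' → HeadInt M M'
head-HeadInt hs (N , ks , ss) = N , hs ◅◅ ks , ss

HeadInt-int : ∀ {M N M'} → HeadInt M N → Star _→int_ N M' → HeadInt M M'
HeadInt-int (K , hs , ss) ts = K , hs , ss ◅◅ ts

-- Recursion on the bound `m`. Without coincidences the body steps are internal; in a collapse,
-- contracting the redex and following `hs` gives `app (lam Q) V` with a smaller derivation for `Q`.
body-HeadInt-value : ∀ m {V A A'} → Value V → (d : A st A') → size d < m →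
                     HeadInt (app (lam A) V) (app (lam A') V)
body-HeadInt-value (suc m) v d (s≤s d≤m) with avoid-or-collapse v top d
... | inj₁ ss = _ , ε , gmap (λ X → app (lam X) _) (int-body-value v) ss
... | inj₂ (Q , hs , d' , lt) = head-HeadInt (root (β (βv _ _ v)) ◅ hs)
  (body-HeadInt-value m v d' (≤-trans (s≤s (m≤n+m (size d') (length hs))) (≤-trans lt d≤m)))

body-HeadInt : ∀ {A A'} → A st A' → ∀ B → HeadInt (app (lam A) B) (app (lam A') B)
body-HeadInt d B with value? B
... | inj₁ v              = body-HeadInt-value (suc (size d)) v d ≤-refl
... | inj₂ (F , E , refl) = _ , ε , skip-loops int-body-nonvalue (st⇒→v* d)

mutual

  st⇒HeadInt : ∀ {M M'} → M st M' → HeadInt M M'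
  st⇒HeadInt (step h d) = head-HeadInt (h ◅ ε) (st⇒HeadInt d)
  st⇒HeadInt (var i)    = _ , ε , ε
  st⇒HeadInt (lam d)    = _ , ε , gmap lam int-lam (st⇒→v* d)
  st⇒HeadInt (app d e)  = st-app⇒HeadInt d e

  st-app⇒HeadInt : ∀ {F F' B B'} → F st F' → B st B' → HeadInt (app F B) (app F' B')
  st-app⇒HeadInt {B = B} (step h d) e =
    head-HeadInt (left B h ◅ ε) (st-app⇒HeadInt d e)
  st-app⇒HeadInt (var i) e with st⇒HeadInt e
  ... | B₁ , hs , ss = _ , right* (var i) hs , gmap (app (var i)) (int-right-value (var i)) ss
  st-app⇒HeadInt (lam {A} {A'} d) e with st⇒HeadInt e
  -- `body-HeadInt` may produce head steps, so it precedes the internal steps of the argument.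
  ... | B₁ , hs , ss = head-HeadInt (right* (lam A) hs)
    (HeadInt-int (body-HeadInt d B₁) (gmap (app (lam A')) (int-right-value (lam A')) ss))
  st-app⇒HeadInt {B = B} (app d₁ d₂) e with st-app⇒HeadInt d₁ d₂
  ... | G , hs , ss =
    -- Behind an application, argument steps are internal up to loops, so `e` enters unfactored.
    _ , left* B hs , int-left* ss ◅◅ skip-loops int-right-nonvalue (st⇒→v* e)

theorem3p4 : ∀ M M' → Star _→v_ M M' →
    ∃[ L ] ∃[ N ] (Star _→hβv_ M L × Star _→hσ_ L N × Star _→int_ N M')
theorem3p4 M M' ss =
  let N , hs , is = st⇒HeadInt (st-→v* st-refl ss)
      L , βs , σs = postpone-σ hs
  in L , N , map head⇒→hβv βs , map head⇒→hσ σs , is
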